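{- Let $n$ be a positive integer. Then there exist non-negative integers $a,b$ with $n = a^2+ab+b^2$ if and only if, in the prime factorization of $n$, every prime other than $3$ that is not of the form $6k+1$ ($k$ an integer) occurs with an even exponent. -}

module Defs where

open import Data.Nat using (ℕ; NonZero; _≟_)
open import Data.Nat.Primality.Factorisation using (factorise; factors)
open import Data.Integer using (+_; _+_; _*_)
open import Data.List using (length; filter)
open import Data.Product using (∃-syntax)
open import Relation.Binary.PropositionalEquality using (_≡_)

-- Multiplicity of p in the list of prime factors of n; it is 0 when p does not occur.
exponent : (p n : ℕ) .{{_ : NonZero n}} → ℕ
exponent p n = length (filter (p ≟_) (factors (factorise n)))

_IsOfForm6k+1 : ℕ → Set
p IsOfForm6k+1 = ∃[ k ] + p ≡ + 6 * k + + 1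

{-# OPTIONS --safe #-}
module Submission where

-- A number A dividing some B² + B + 1, say A C = B² + B + 1, is of the form
-- a² + ab + b²: the form A x² + (2B + 1) x y + C y² has discriminant -3, and
-- the Euclidean algorithm on its coefficients brings it to x² + xy + y².
-- A prime p = 3k + 1 divides such a number, with B = x^k a primitive cube root
-- of unity modulo p.  A prime p = 3k + 2 is not of the form a² + ab + b² (look
-- modulo 3), so by the same criterion it can divide a² + ab + b² only if it
-- divides both a and b.  The theorem follows since the values of the form are
-- closed under products.

open import Defs
open import Data.Fin.Base using (zero; suc; toℕ; fromℕ; inject₁)
open import Data.Fin.Properties using (toℕ-fromℕ; toℕ-inject₁; toℕ<n)
import Data.Integer.Base as ℤ
import Data.Integer.Properties as ℤ
open import Data.List.Base using ([]; _∷_; length; filter)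
open import Data.List.Properties using (filter-accept; filter-reject; filter-none)
open import Data.List.Relation.Binary.Permutation.Propositional.Properties
  using (filter-↭; ↭-length)
import Data.List.Relation.Unary.All as All
open import Data.Nat
  using (+-*-rawSemiring; ℕ; zero; suc; NonZero; _+_; _*_; _^_; _∸_; _!; _<_; _≤_; _≤?_
    ; _≟_; z≤n; s≤s; z<s; s<s; ≢-nonZero; nonTrivial⇒n>1; >-nonZero; >-nonZero⁻¹)
open import Data.Nat.Combinatorics
  using (nCn≡1; nCk≡n!/k![n-k]!; k![n∸k]!∣n!)
  renaming (_C_ to _choose_)
open import Data.Nat.DivMod
  using (_/_; _%_; m/n*n≡m; m≡m%n+[m/n]*n; m%n<n; [m+kn]%n≡m%n; %-distribˡ-*)
open import Data.Nat.Divisibility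
  using (_∣_; quotient; m∣n⇒n≡quotient*m; m∣n⇒n≡m*quotient; _∤_; divides; _∣?_; ∣-refl
    ; ∣1⇒≡1; >⇒∤; m∣m*n; n∣m*n; ∣m⇒∣m*n; ∣m∣n⇒∣m+n; ∣m+n∣m⇒∣n; _∣0)
open import Data.Nat.Induction using (<-rec; <-wellFounded)
open import Data.Nat.ListAction using (product)
open import Data.Nat.ListAction.Properties using (∈⇒∣product)
open import Data.Nat.Primality
  using (Prime; prime⇒nonTrivial; prime⇒irreducible; euclidsLemma; ¬prime[1]; ¬prime[0]
    ; prime[2]; prime?)
open import Data.Nat.Primality.Factorisation
  using (PrimeFactorisation; factorise; factors; factorisationUnique)
open import Data.Nat.Properties
open import Data.Nat.Tactic.RingSolver using (solve-∀)
open import Data.Product using (∃-syntax; _×_; _,_)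
open import Data.Sum using (_⊎_; inj₁; inj₂; [_,_])
open import Data.Vec.Base using (Vec; []; _∷_; replicate)
open import Data.Vec.Functional using (Vector)
open import Function using (_∘_; case_of_)
open import Function.Bundles using (_⇔_; mk⇔)
open import Induction.WellFounded using (Acc; acc)
open import Relation.Binary.PropositionalEquality
  using (_≡_; _≢_; refl; sym; trans; cong; cong₂; subst; subst₂; module ≡-Reasoning)
open import Relation.Nullary using (¬_; yes; no; contradiction; ¬?)
open import Relation.Nullary.Decidable using (decidable-stable; from-yes)
open import Algebra.Definitions.RawSemiring +-*-rawSemiring
  using ()
  renaming (_^_ to _^ˢ_; _×_ to _×ˢ_)
open import Algebra.Properties.CommutativeSemiring.Binomial +-*-commutativeSemiring
  using (binomialTerm)
  renaming (theorem to binomialTheorem)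
open import Algebra.Properties.AbelianGroup ℤ.+-0-abelianGroup using (∙-cancelʳ)
open import Algebra.Properties.Semiring.Sum +-*-semiring using (sum; sum-init-last)

-- Fermat's little theorem

prime∤! : ∀ {p} → Prime p → ∀ {k} → k < p → p ∤ k !
prime∤! {p} pr {zero}  k<p p∣1 = ¬prime[1] (subst Prime (∣1⇒≡1 p∣1) pr)
prime∤! {p} pr {suc k} k<p p∣k! with euclidsLemma (suc k) (k !) pr p∣k!
... | inj₁ p∣1+k = >⇒∤ k<p p∣1+k
... | inj₂ p∣k!′ = prime∤! pr (<-trans (n<1+n k) k<p) p∣k!′

nCk*k![n∸k]!≡n! : ∀ {n k} → k ≤ n → (n choose k) * (k ! * (n ∸ k) !) ≡ n !
nCk*k![n∸k]!≡n! {n} {k} k≤n = trans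
  (cong (_* (k ! * (n ∸ k) !)) (nCk≡n!/k![n-k]! k≤n))
  (m/n*n≡m {{k !* (n ∸ k) !≢0}} (k![n∸k]!∣n! k≤n))

-- `p` divides p ! = C(p, k) k ! (p - k) !, but neither of the two factorials, which are products of
-- numbers below `p`; Euclid's lemma leaves the binomial coefficient.
prime∣C : ∀ {p k} → Prime p → 0 < k → k < p → p ∣ p choose k
prime∣C {p@(suc m)} {k} pr 0<k k<p
  with euclidsLemma (p choose k) (k ! * (p ∸ k) !) pr
         (subst (p ∣_) (sym (nCk*k![n∸k]!≡n! (<⇒≤ k<p))) (m∣m*n (m !)))
... | inj₁ p∣C = p∣C
... | inj₂ p∣k![p-k]! with euclidsLemma (k !) ((p ∸ k) !) pr p∣k![p-k]!
...   | inj₁ p∣k! = contradiction p∣k! (prime∤! pr k<p)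
...   | inj₂ p∣[p-k]! = contradiction p∣[p-k]! (prime∤! pr (∸-monoʳ-< 0<k (<⇒≤ k<p)))
prime∣C {zero} pr _ _ = contradiction pr ¬prime[0]

∣-sum : ∀ {d n} (t : Vector ℕ n) → (∀ i → d ∣ t i) → d ∣ sum t
∣-sum {d} {zero}  t d∣t = d ∣0
∣-sum {d} {suc n} t d∣t = ∣m∣n⇒∣m+n (d∣t zero) (∣-sum (t ∘ suc) (d∣t ∘ suc))

^ˢ≡^ : ∀ x n → x ^ˢ n ≡ x ^ n
^ˢ≡^ x zero    = refl
^ˢ≡^ x (suc n) = cong (x *_) (^ˢ≡^ x n)

×ˢ≡* : ∀ n x → n ×ˢ x ≡ n * x
×ˢ≡* zero    x = refl
×ˢ≡* (suc n) x = cong (x +_) (×ˢ≡* n x)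

-- All terms of the binomial expansion except the two outer ones are multiples of `p`. The exponent
-- of 1 counts up, so the first term is `a ^ p` and the last is 1.
freshman's-dream : ∀ {p} → Prime p → ∀ a → ∃[ s ] (1 + a) ^ p ≡ 1 + a ^ p + s * p
freshman's-dream {zero} pr a = contradiction pr ¬prime[0]
freshman's-dream {p@(suc m)} pr a = quotient p∣sum , (begin
  (1 + a) ^ p                                      ≡⟨ ^ˢ≡^ (1 + a) p ⟨
  (1 + a) ^ˢ p                                     ≡⟨ binomialTheorem p 1 a ⟩
  term zero + sum (term ∘ suc)                     ≡⟨ cong (term zero +_) (sum-init-last (term ∘ suc)) ⟩
  term zero + (sum middle + term (suc (fromℕ m)))  ≡⟨ cong₂ _+_ first (cong₂ _+_ (m∣n⇒n≡quotient*m p∣sum) last) ⟩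
  a ^ p + (quotient p∣sum * p + 1)                 ≡⟨ rearrange (a ^ p) (quotient p∣sum * p) ⟩
  1 + a ^ p + quotient p∣sum * p                   ∎)
  where
  open ≡-Reasoning

  term : Vector ℕ (suc p)
  term = binomialTerm 1 a p

  middle : Vector ℕ m
  middle i = term (suc (inject₁ i))

  p∣middle : ∀ i → p ∣ middle i
  p∣middle i = subst (p ∣_) (sym (×ˢ≡* (p choose k) _)) (∣m⇒∣m*n _ (prime∣C pr z<s k<p))
    where
    k = toℕ (suc (inject₁ i))
    k<p : k < p
    k<p = s<s (subst (_< m) (sym (toℕ-inject₁ i)) (toℕ<n i))

  p∣sum : p ∣ sum middle
  p∣sum = ∣-sum middle p∣middle

  first : term zero ≡ a ^ p
  first = trans (trans (+-identityʳ _) (*-identityˡ _)) (^ˢ≡^ a p)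

  last : term (suc (fromℕ m)) ≡ 1
  last rewrite toℕ-fromℕ m | nCn≡1 p | n∸n≡0 m = begin
    1 * 1 ^ˢ m * 1 + 0  ≡⟨ cong (λ z → 1 * z * 1 + 0) (trans (^ˢ≡^ 1 m) (^-zeroˡ m)) ⟩
    1                   ∎

  rearrange : ∀ x y → x + (y + 1) ≡ 1 + x + y
  rearrange = solve-∀

-- Induction on `a`. Since `a ^ p` is at least `a`, the congruence can be an equation in ℕ with an
-- explicit multiple of `p`.
fermat : ∀ {p} → Prime p → ∀ a → ∃[ s ] a ^ p ≡ a + s * p
fermat {zero}  pr _       = contradiction pr ¬prime[0]
fermat {suc _} pr zero    = 0 , refl
fermat {p}     pr (suc a) with freshman's-dream pr a | fermat pr a
... | s , [1+a]^p≡ | t , a^p≡ = t + s , (begin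
  suc a ^ p                ≡⟨ [1+a]^p≡ ⟩
  1 + a ^ p + s * p        ≡⟨ cong (λ z → 1 + z + s * p) a^p≡ ⟩
  1 + (a + t * p) + s * p  ≡⟨ rearrange a s t p ⟩
  suc a + (t + s) * p      ∎)
  where
  open ≡-Reasoning
  rearrange : ∀ a s t p → 1 + (a + t * p) + s * p ≡ 1 + a + (t + s) * p
  rearrange = solve-∀

-- Inverses modulo a prime

*-cancelˡ-mod : ∀ {p b x s} → Prime p → p ∤ b → 0 < x → b * x ≡ b + s * p → ∃[ w ] x ≡ 1 + w * p
-- Positivity of x lets `y` stand for x - 1, so the difference of the two sides is `b * y` without
-- subtraction.
*-cancelˡ-mod {p} {b} {suc y} {s} pr p∤b _ bx≡ with euclidsLemma b y pr (divides s by≡sp)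
  where
  by≡sp : b * y ≡ s * p
  by≡sp = +-cancelˡ-≡ b _ _ (trans (sym (*-suc b y)) bx≡)
... | inj₁ p∣b = contradiction p∣b p∤b
... | inj₂ (divides w y≡) = w , cong suc y≡

∤⇒nonZero : ∀ {m n} → m ∤ n → NonZero n
∤⇒nonZero m∤n = ≢-nonZero λ { refl → m∤n (_ ∣0) }

-- The inverse is b ^ (p - 2): cancelling one `b` in Fermat's congruence leaves b ^ (p - 1)
-- congruent to 1.
inverse : ∀ {p b} → Prime p → p ∤ b → ∃[ c ] ∃[ w ] b * c ≡ 1 + w * p
inverse {zero}            pr _   = contradiction pr ¬prime[0]
inverse {suc zero}        pr _   = contradiction pr ¬prime[1]
inverse {suc (suc m)} {b} pr p∤b with fermat pr b
... | s , b^p≡ = b ^ m , *-cancelˡ-mod {s = s} pr p∤b (m^n>0 b {{∤⇒nonZero p∤b}} (suc m)) b^p≡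

-- Roots of monic polynomials modulo a prime

-- The polynomial c₀ + c₁ x + … + c_{d-1} x^{d-1} + x^d.
monic : ∀ {d} → Vec ℕ d → ℕ → ℕ
monic []       x = 1
monic (c ∷ cs) x = c + x * monic cs x

-- The quotient of f(x) - f(r) by x - r.
divide : ∀ {d} → Vec ℕ (suc d) → ℕ → Vec ℕ d
divide (c ∷ [])         r = []
divide (c ∷ cs@(_ ∷ _)) r = monic cs r ∷ divide cs r

-- Synthetic division. The point r is written `x + e`, so that the factor r - x is the natural
-- number `e`.
monic-divide : ∀ {d} (cs : Vec ℕ (suc d)) x e →
               monic cs (x + e) ≡ monic cs x + e * monic (divide cs (x + e)) x
monic-divide (c ∷ []) x e = rearrange c x e
  where
  rearrange : ∀ c x e → c + (x + e) * 1 ≡ c + x * 1 + e * 1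
  rearrange = solve-∀
monic-divide (c ∷ cs@(_ ∷ _)) x e = begin
  c + (x + e) * monic cs (x + e)                       ≡⟨ split c x e (monic cs (x + e)) ⟩
  c + x * monic cs (x + e) + e * monic cs (x + e)      ≡⟨ cong (λ z → c + x * z + e * monic cs (x + e)) (monic-divide cs x e) ⟩
  c + x * (monic cs x + e * q) + e * monic cs (x + e)  ≡⟨ rearrange c x e (monic cs x) q (monic cs (x + e)) ⟩
  c + x * monic cs x + e * (monic cs (x + e) + x * q)  ∎
  where
  open ≡-Reasoning
  q = monic (divide cs (x + e)) x
  split : ∀ c x e g → c + (x + e) * g ≡ c + x * g + e * g
  split = solve-∀
  rearrange : ∀ c x e g q h → c + x * (g + e * q) + e * h ≡ c + x * g + e * (h + x * q)
  rearrange = solve-∀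

-- Lagrange's bound on the number of roots, by induction on the degree: dividing by x minus the
-- largest root gives a quotient that vanishes at all smaller ones, because the differences lie
-- strictly between 0 and `p`. In degree 0 the polynomial is 1.
monic-nonvanishing : ∀ {p d} → Prime p → (cs : Vec ℕ d) → d < p →
                     ¬ (∀ x → x ≤ d → p ∣ monic cs x)
monic-nonvanishing pr [] d<p p∣f = ¬prime[1] (subst Prime (∣1⇒≡1 (p∣f 0 z≤n)) pr)
monic-nonvanishing {p} {suc d} pr cs@(_ ∷ _) d<p p∣f =
  monic-nonvanishing pr (divide cs (suc d)) (<-trans (n<1+n d) d<p) p∣q
  where
  p∣q : ∀ x → x ≤ d → p ∣ monic (divide cs (suc d)) x
  p∣q x x≤d with euclidsLemma e (monic (divide cs (suc d)) x) pr p∣e*q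
    where
    e = suc d ∸ x
    p∣e*q : p ∣ e * monic (divide cs (suc d)) x
    p∣e*q = ∣m+n∣m⇒∣n (subst (p ∣_) f[1+d]≡ (p∣f (suc d) ≤-refl)) (p∣f x (m≤n⇒m≤1+n x≤d))
      where
      f[1+d]≡ : monic cs (suc d) ≡ monic cs x + e * monic (divide cs (suc d)) x
      f[1+d]≡ = subst (λ r → monic cs r ≡ monic cs x + e * monic (divide cs r) x)
        (m+[n∸m]≡n (m≤n⇒m≤1+n x≤d)) (monic-divide cs x e)
  ... | inj₂ p∣q = p∣q
  ... | inj₁ p∣e = contradiction p∣e (>⇒∤ {{>-nonZero (m<n⇒0<n∸m (s≤s x≤d))}} (≤-<-trans (m∸n≤m (suc d) x) d<p))

-- Here m stands for -1: otherwise x^{k+1} - x would vanish modulo p at 0, …, k+1.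
∃-nonroot : ∀ {m} k .{{_ : NonZero k}} → Prime (suc m) → k < m → ∃[ x ] suc m ∤ x * (m + x ^ k)
∃-nonroot {m} k@(suc j) pr k<m with anyUpTo? (λ x → ¬? (suc m ∣? x * (m + x ^ k))) (2 + k)
... | yes (x , _ , p∤) = x , p∤
... | no ∄x = contradiction p∣f (monic-nonvanishing pr cs (s<s k<m))
  where
  cs : Vec ℕ (suc k)
  -- The coefficients of x (m + x ^ k), of degree k + 1 < p; the search bound `2 + k` covers exactly
  -- x = 0, ..., k + 1.
  cs = 0 ∷ m ∷ replicate j 0

  monic-replicate : ∀ x i → monic (replicate i 0) x ≡ x ^ i
  monic-replicate x zero    = refl
  monic-replicate x (suc i) = cong (x *_) (monic-replicate x i)

  p∣f : ∀ x → x ≤ suc k → suc m ∣ monic cs x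
  p∣f x x≤1+k = subst (λ z → suc m ∣ x * (m + x * z)) (sym (monic-replicate x j))
    (decidable-stable (suc m ∣? _) (λ p∤ → ∄x (x , s≤s x≤1+k , p∤)))

-- Primitive cube roots of unity modulo a prime

∣x³ᵏ-1⇒∣x²ᵏ+xᵏ+1 : ∀ {m} x k s .{{_ : NonZero x}} → Prime (suc m) →
  x * x ^ (k * 3) ≡ x + s * suc m → suc m ∤ x * (m + x ^ k) →
  suc m ∣ x ^ k * x ^ k + x ^ k + 1
∣x³ᵏ-1⇒∣x²ᵏ+xᵏ+1 {m} x k s pr x^p≡ p∤f =
  [ (λ p∣xc → contradiction p∣xc p∤xc) , (λ p∣N → p∣N) ]
    (euclidsLemma (x * c) (B * B + B + 1) pr (divides s xc[B²+B+1]≡sp))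
  where
  open ≡-Reasoning
  B c : ℕ
  B = x ^ k
  c = B ∸ 1

  B≡1+c : B ≡ 1 + c
  B≡1+c = sym (m+[n∸m]≡n (m^n>0 x k))

  -- As `m` is -1 modulo the prime, `x * c` and `x * (m + B)` are congruent.
  p∤xc : suc m ∤ x * c
  p∤xc p∣xc = p∤f (subst (suc m ∣_) (sym f≡) (∣m∣n⇒∣m+n p∣xc (n∣m*n x)))
    where
    rearrange : ∀ x m c → x * (m + (1 + c)) ≡ x * c + x * (1 + m)
    rearrange = solve-∀
    f≡ : x * (m + B) ≡ x * c + x * suc m
    f≡ = trans (cong (λ z → x * (m + z)) B≡1+c) (rearrange x m c)

  -- The left side is x (B³ - 1), factored with c = B - 1; adding x to it gives the power of x in
  -- `x^p≡`.
  xc[B²+B+1]≡sp : x * c * (B * B + B + 1) ≡ s * suc m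
  xc[B²+B+1]≡sp = +-cancelˡ-≡ x _ _ (begin
    x + x * c * (B * B + B + 1)                    ≡⟨ cong (λ z → x + x * c * (z * z + z + 1)) B≡1+c ⟩
    x + x * c * ((1 + c) * (1 + c) + (1 + c) + 1)  ≡⟨ cube x c ⟩
    x * (1 + c) ^ 3                                ≡⟨ cong (λ z → x * z ^ 3) B≡1+c ⟨
    x * B ^ 3                                      ≡⟨ cong (x *_) (^-*-assoc x k 3) ⟩
    x * x ^ (k * 3)                                ≡⟨ x^p≡ ⟩
    x + s * suc m                                  ∎)
    where
    cube : ∀ x c → x + x * c * ((1 + c) * (1 + c) + (1 + c) + 1) ≡ x * ((1 + c) * ((1 + c) * ((1 + c) * 1)))
    cube = solve-∀

∃-primitive-cube-root : ∀ k → Prime (1 + k * 3) → ∃[ B ] 1 + k * 3 ∣ B * B + B + 1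
∃-primitive-cube-root zero pr = contradiction pr ¬prime[1]
∃-primitive-cube-root k@(suc _) pr with ∃-nonroot k pr (m<m*n k 3 (s≤s (s≤s z≤n)))
... | x , p∤f with fermat pr x
...   | s , x^p≡ = x ^ k , ∣x³ᵏ-1⇒∣x²ᵏ+xᵏ+1 x k s {{∤⇒nonZero p∤x}} pr x^p≡ p∤f
  where
  p∤x : suc (k * 3) ∤ x
  p∤x p∣x = p∤f (∣m⇒∣m*n _ p∣x)

-- The form a² + ab + b²

norm : ℕ → ℕ → ℕ
norm a b = a * a + a * b + b * b

IsNorm : ℕ → Set
IsNorm n = ∃[ a ] ∃[ b ] n ≡ norm a b

-- norm (a + c) (b + d) = norm a b + polar a b c d + norm c d.
polar : ℕ → ℕ → ℕ → ℕ → ℕ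
polar a b c d = 2 * (a * c) + a * d + b * c + 2 * (b * d)

-- The form A x² + (2B + 1) x y + C y² arises from x² + xy + y² by a linear
-- substitution with the non-negative columns (a , b) and (c , d).
Represents : ℕ → ℕ → ℕ → Set
Represents A B C = ∃[ a ] ∃[ b ] ∃[ c ] ∃[ d ]
  A ≡ norm a b × C ≡ norm c d × 1 + 2 * B ≡ polar a b c d

represents-swap : ∀ {A B C} → Represents A B C → Represents C B A
represents-swap (a , b , c , d , A≡ , C≡ , B≡) = c , d , a , b , C≡ , A≡ , trans B≡ (polar-comm a b c d)
  where
  polar-comm : ∀ a b c d → 2 * (a * c) + a * d + b * c + 2 * (b * d)
                         ≡ 2 * (c * a) + c * b + d * a + 2 * (d * b)
  polar-comm = solve-∀

-- The first column is added to the second; the new last coefficient is the value of the form at (1,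
-- 1).
represents-shift : ∀ {A B C} → Represents A B C → Represents A (A + B) (A + (1 + 2 * B) + C)
represents-shift {A} {B} {C} (a , b , c , d , A≡ , C≡ , B≡) =
  a , b , a + c , b + d , A≡
  , trans (cong₂ _+_ (cong₂ _+_ A≡ B≡) C≡) (norm-+ a b c d)
  , trans (rearrange A B) (trans (cong₂ (λ x y → 2 * x + y) A≡ B≡) (polar-+ a b c d))
  where
  rearrange : ∀ A B → 1 + 2 * (A + B) ≡ 2 * A + (1 + 2 * B)
  rearrange = solve-∀
  norm-+ : ∀ a b c d →
    a * a + a * b + b * b + (2 * (a * c) + a * d + b * c + 2 * (b * d)) + (c * c + c * d + d * d)
    ≡ (a + c) * (a + c) + (a + c) * (b + d) + (b + d) * (b + d)
  norm-+ = solve-∀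
  polar-+ : ∀ a b c d →
    2 * (a * a + a * b + b * b) + (2 * (a * c) + a * d + b * c + 2 * (b * d))
    ≡ 2 * (a * (a + c)) + a * (b + d) + b * (a + c) + 2 * (b * (b + d))
  polar-+ = solve-∀

-- The substitution x ↦ x - y turns (A , A + B′ , C) into (A , B′ , C′).
∃-shift : ∀ A B′ C .{{_ : NonZero A}} → A * C ≡ (A + B′) * (A + B′) + (A + B′) + 1 →
          ∃[ C′ ] A * C′ ≡ B′ * B′ + B′ + 1 × C ≡ A + (1 + 2 * B′) + C′
∃-shift A B′ C AC≡ = quotient A∣N , sym N≡ , *-cancelˡ-≡ C _ A (begin
  A * C                                           ≡⟨ AC≡′ ⟩
  A * (A + (1 + 2 * B′)) + (B′ * B′ + B′ + 1)     ≡⟨ cong (A * (A + (1 + 2 * B′)) +_) N≡ ⟩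
  A * (A + (1 + 2 * B′)) + A * quotient A∣N       ≡⟨ *-distribˡ-+ A (A + (1 + 2 * B′)) (quotient A∣N) ⟨
  A * (A + (1 + 2 * B′) + quotient A∣N)           ∎)
  where
  open ≡-Reasoning
  expand : ∀ A B → (A + B) * (A + B) + (A + B) + 1 ≡ A * (A + (1 + 2 * B)) + (B * B + B + 1)
  expand = solve-∀

  AC≡′ : A * C ≡ A * (A + (1 + 2 * B′)) + (B′ * B′ + B′ + 1)
  AC≡′ = trans AC≡ (expand A B′)

  A∣N : A ∣ B′ * B′ + B′ + 1
  A∣N = ∣m+n∣m⇒∣n (subst (A ∣_) AC≡′ (m∣m*n C)) (m∣m*n (A + (1 + 2 * B′)))

  N≡ : B′ * B′ + B′ + 1 ≡ A * quotient A∣N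
  N≡ = m∣n⇒n≡m*quotient A∣N

-- The hypothesis says that the discriminant (2B + 1)² - 4AC is -3. If `A` or `C` is at most `B`, a
-- shift lowers `B`. Otherwise AC is at least (B + 1)², which exceeds B² + B + 1 unless B = 0; then
-- A = C = 1, and the identity substitution serves.
represents : ∀ {A B C} → Acc _<_ B → A * C ≡ B * B + B + 1 → Represents A B C

represents-≤ : ∀ {A B C} → Acc _<_ B → A * C ≡ B * B + B + 1 → A ≤ B → Represents A B C
represents-≤ {A} {B} {C} (acc rs) AC≡ A≤B =
  let C′ , AC′≡ , C≡ = ∃-shift A (B ∸ A) C AC≡′ in
  subst₂ (Represents A) A+[B∸A]≡B (sym C≡)
    (represents-shift {B = B ∸ A} (represents (rs (∸-monoʳ-< (>-nonZero⁻¹ A) A≤B)) AC′≡))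
  where
  -- A C = B² + B + 1 is positive, hence so is `A`; this makes `B ∸ A` smaller than `B`.
  instance
    A≢0 : NonZero A
    A≢0 = m*n≢0⇒m≢0 A {{subst NonZero (trans (+-comm 1 (B * B + B)) (sym AC≡)) _}}

  A+[B∸A]≡B : A + (B ∸ A) ≡ B
  A+[B∸A]≡B = m+[n∸m]≡n A≤B

  AC≡′ : A * C ≡ (A + (B ∸ A)) * (A + (B ∸ A)) + (A + (B ∸ A)) + 1
  AC≡′ = subst (λ z → A * C ≡ z * z + z + 1) (sym A+[B∸A]≡B) AC≡

represents {A} {B} {C} rec AC≡ with A ≤? B | C ≤? B | B ≟ 0
... | yes A≤B | _ | _ = represents-≤ rec AC≡ A≤B
... | no _ | yes C≤B | _ = represents-swap {B = B} (represents-≤ rec (trans (*-comm C A) AC≡) C≤B)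
... | no _ | no _ | yes refl
  with refl ← m*n≡1⇒m≡1 A C AC≡ | refl ← m*n≡1⇒n≡1 A C AC≡ = 1 , 0 , 0 , 1 , refl , refl , refl
... | no A≰B | no C≰B | no B≢0 = contradiction AC≡ (>⇒≢ (begin-strict
  B * B + B + 1      <⟨ m<m+n (B * B + B + 1) (n≢0⇒n>0 B≢0) ⟩
  B * B + B + 1 + B  ≡⟨ square B ⟩
  (1 + B) * (1 + B)  ≤⟨ *-mono-≤ (≰⇒> A≰B) (≰⇒> C≰B) ⟩
  A * C              ∎))
  where
  open ≤-Reasoning
  square : ∀ B → B * B + B + 1 + B ≡ (1 + B) * (1 + B)
  square = solve-∀

∣B²+B+1⇒isNorm : ∀ {A} B → A ∣ B * B + B + 1 → IsNorm A
∣B²+B+1⇒isNorm B A∣N with represents (<-wellFounded B) (sym (m∣n⇒n≡m*quotient A∣N))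
... | a , b , _ , _ , A≡ , _ = a , b , A≡

-- If ac = bd + e then (a - bω)(c - dω) = e - (ad + bc + bd)ω where ω² + ω + 1 = 0.
norm-* : ∀ a b c d e → a * c ≡ b * d + e →
         norm a b * norm c d ≡ norm e (a * d + b * c + b * d)
norm-* a b c d e ac≡ = +-cancelʳ-≡ (b * d * (a * c)) _ _ (begin
  -- With P = ac, Q = bd and S = ad + bc the product of the norms is P² + Q² + S² + PS + QS - PQ;
  -- adding PQ to both sides avoids the negative term.
  norm a b * norm c d + b * d * (a * c)     ≡⟨ expand a b c d ⟩
  poly (a * c) (b * d) S                    ≡⟨ cong (λ z → poly z (b * d) S) ac≡ ⟩
  poly (b * d + e) (b * d) S                ≡⟨ collect (b * d) e S ⟩
  norm e (S + b * d) + b * d * (b * d + e)  ≡⟨ cong (λ z → norm e (S + b * d) + b * d * z) ac≡ ⟨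
  norm e (S + b * d) + b * d * (a * c)      ∎)
  where
  open ≡-Reasoning
  S : ℕ
  S = a * d + b * c
  poly : ℕ → ℕ → ℕ → ℕ
  poly P Q S = P * P + Q * Q + S * S + P * S + Q * S
  expand : ∀ a b c d →
    (a * a + a * b + b * b) * (c * c + c * d + d * d) + b * d * (a * c)
    ≡ (a * c) * (a * c) + (b * d) * (b * d) + (a * d + b * c) * (a * d + b * c)
      + (a * c) * (a * d + b * c) + (b * d) * (a * d + b * c)
  expand = solve-∀
  collect : ∀ Q e S → (Q + e) * (Q + e) + Q * Q + S * S + (Q + e) * S + Q * S
                    ≡ e * e + e * (S + Q) + (S + Q) * (S + Q) + Q * (Q + e)
  collect = solve-∀

norm-comm : ∀ a b → norm a b ≡ norm b a
norm-comm = comm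
  where
  comm : ∀ a b → a * a + a * b + b * b ≡ b * b + b * a + a * a
  comm = solve-∀

isNorm-* : ∀ {m n} → IsNorm m → IsNorm n → IsNorm (m * n)
isNorm-* (a , b , m≡) (c , d , n≡) with ≤-total (b * d) (a * c)
... | inj₁ bd≤ac = a * c ∸ b * d , a * d + b * c + b * d , trans (cong₂ _*_ m≡ n≡)
  (norm-* a b c d (a * c ∸ b * d) (sym (m+[n∸m]≡n bd≤ac)))
-- Swapping the entries of both pairs turns the difference into bd - ac, which is now non-negative.
... | inj₂ ac≤bd = b * d ∸ a * c , b * c + a * d + a * c , trans (cong₂ _*_ (trans m≡ (norm-comm a b)) (trans n≡ (norm-comm c d)))
  (norm-* b a d c (b * d ∸ a * c) (sym (m+[n∸m]≡n ac≤bd)))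

isNorm-square : ∀ p → IsNorm (p * p)
isNorm-square p = p , 0 , square p
  where
  square : ∀ p → p * p ≡ p * p + p * 0 + 0 * 0
  square = solve-∀

-- Inert primes

square%3≢2 : ∀ x → x * x % 3 ≢ 2
square%3≢2 x eq with x % 3 | %-distribˡ-* x x 3 | m%n<n x 3
... | 0 | h | _ = contradiction (trans (sym h) eq) λ ()
... | 1 | h | _ = contradiction (trans (sym h) eq) λ ()
... | 2 | h | _ = contradiction (trans (sym h) eq) λ ()
... | suc (suc (suc _)) | _ | s≤s (s≤s (s≤s ()))

-- Modulo 3 the form is the square of a + 2b, and 2 is not a square modulo 3.
¬isNorm[2+3k] : ∀ k → ¬ IsNorm (2 + k * 3)
¬isNorm[2+3k] k (a , b , eq) = square%3≢2 (a + 2 * b) (begin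
  (a + 2 * b) * (a + 2 * b) % 3          ≡⟨ cong (_% 3) (complete a b) ⟩
  (norm a b + (a * b + b * b) * 3) % 3   ≡⟨ cong (λ z → (z + (a * b + b * b) * 3) % 3) eq ⟨
  (2 + k * 3 + (a * b + b * b) * 3) % 3  ≡⟨ [m+kn]%n≡m%n (2 + k * 3) (a * b + b * b) 3 ⟩
  (2 + k * 3) % 3                        ≡⟨ [m+kn]%n≡m%n 2 k 3 ⟩
  2                                      ∎)
  where
  open ≡-Reasoning
  complete : ∀ a b → (a + 2 * b) * (a + 2 * b) ≡ a * a + a * b + b * b + (a * b + b * b) * 3
  complete = solve-∀

-- Modulo p, a quotient a / b would be a root of X² + X + 1, making p a norm.
∣norm⇒∣ʳ : ∀ {p a b} → Prime p → ¬ IsNorm p → p ∣ norm a b → p ∣ b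
∣norm⇒∣ʳ {p} {a} {b} pr ¬norm p∣N with p ∣? b
... | yes p∣b = p∣b
... | no p∤b with inverse pr p∤b
...   | c , w , bc≡ = contradiction (∣B²+B+1⇒isNorm B p∣B²+B+1) ¬norm
  where
  open ≡-Reasoning
  B = a * c

  scale : ∀ a b c → (a * a + a * b + b * b) * (c * c)
                  ≡ (a * c) * (a * c) + (a * c) * (b * c) + (b * c) * (b * c)
  scale = solve-∀
  expand : ∀ B w p → B * B + B * (1 + w * p) + (1 + w * p) * (1 + w * p)
                   ≡ (B * w + w * 2 + w * w * p) * p + (B * B + B + 1)
  expand = solve-∀

  N*c²≡ : norm a b * (c * c) ≡ (B * w + w * 2 + w * w * p) * p + (B * B + B + 1)
  N*c²≡ = begin
    norm a b * (c * c)                                   ≡⟨ scale a b c ⟩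
    B * B + B * (b * c) + (b * c) * (b * c)              ≡⟨ cong (λ z → B * B + B * z + z * z) bc≡ ⟩
    B * B + B * (1 + w * p) + (1 + w * p) * (1 + w * p)  ≡⟨ expand B w p ⟩
    (B * w + w * 2 + w * w * p) * p + (B * B + B + 1)    ∎

  p∣B²+B+1 : p ∣ B * B + B + 1
  p∣B²+B+1 = ∣m+n∣m⇒∣n (subst (p ∣_) N*c²≡ (∣m⇒∣m*n (c * c) p∣N)) (n∣m*n (B * w + w * 2 + w * w * p))

∣norm⇒∣ˡ : ∀ {p a b} → Prime p → ¬ IsNorm p → p ∣ norm a b → p ∣ a
∣norm⇒∣ˡ {p} {a} {b} pr ¬norm p∣N = ∣norm⇒∣ʳ {a = b} pr ¬norm (subst (p ∣_) (norm-comm a b) p∣N)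

-- Exponents

-- Prepending `p` to the factors of `m` gives a factorisation of `p * m`. Factorisations are unique
-- up to permutation, which preserves multiplicities.
exponent-* : ∀ {p} q m .{{_ : NonZero m}} .{{_ : NonZero (p * m)}} → Prime p →
             exponent q (p * m) ≡ length (filter (q ≟_) (p ∷ factors (factorise m)))
exponent-* {p} q m pr = ↭-length (filter-↭ (q ≟_) (factorisationUnique (factorise (p * m)) record
  { factors         = p ∷ factors (factorise m)
  ; isFactorisation = cong (p *_) (isFactorisation (factorise m))
  ; factorsPrime    = pr All.∷ factorsPrime (factorise m)
  }))
  where open PrimeFactorisation using (isFactorisation; factorsPrime)

exponent-*-≡ : ∀ {p} m .{{_ : NonZero m}} .{{_ : NonZero (p * m)}} → Prime p →
               exponent p (p * m) ≡ suc (exponent p m)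
exponent-*-≡ {p} m pr = trans (exponent-* p m pr) (cong length (filter-accept (p ≟_) refl))

exponent-*-≢ : ∀ {p q} m .{{_ : NonZero m}} .{{_ : NonZero (p * m)}} → Prime p → q ≢ p →
               exponent q (p * m) ≡ exponent q m
exponent-*-≢ {p} {q} m pr q≢p = trans (exponent-* q m pr) (cong length (filter-reject (q ≟_) q≢p))

exponent-p*p*-≡ : ∀ {p} m .{{_ : NonZero m}} .{{_ : NonZero (p * (p * m))}} → Prime p →
                  exponent p (p * (p * m)) ≡ 2 + exponent p m
exponent-p*p*-≡ {p} m pr = trans (exponent-*-≡ (p * m) pr) (cong suc (exponent-*-≡ m pr))
  where instance _ = m*n≢0⇒n≢0 p {p * m}

exponent-p*p*-≢ : ∀ {p q} m .{{_ : NonZero m}} .{{_ : NonZero (p * (p * m))}} → Prime p → q ≢ p →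
                  exponent q (p * (p * m)) ≡ exponent q m
exponent-p*p*-≢ {p} m pr q≢p = trans (exponent-*-≢ (p * m) pr q≢p) (exponent-*-≢ m pr q≢p)
  where instance _ = m*n≢0⇒n≢0 p {p * m}

∤⇒exponent≡0 : ∀ {p} n .{{_ : NonZero n}} → p ∤ n → exponent p n ≡ 0
∤⇒exponent≡0 {p} n p∤n = cong length (filter-none (p ≟_) {factors (factorise n)} (All.tabulate λ q∈ p≡q →
  p∤n (subst₂ _∣_ (sym p≡q) (sym (PrimeFactorisation.isFactorisation (factorise n))) (∈⇒∣product q∈))))

1⊎prime* : ∀ n .{{_ : NonZero n}} → n ≡ 1 ⊎ ∃[ p ] ∃[ m ] Prime p × n ≡ p * m
1⊎prime* n with factorise n
... | record { factors = [] ; isFactorisation = n≡ } = inj₁ n≡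
... | record { factors = p ∷ ps ; isFactorisation = n≡ ; factorsPrime = pr All.∷ _ } =
  inj₂ (p , product ps , pr , n≡)

-- Primes modulo 6

prime∣prime⇒≡ : ∀ {p q} → Prime p → Prime q → p ∣ q → p ≡ q
prime∣prime⇒≡ pr qr p∣q with prime⇒irreducible qr p∣q
... | inj₁ refl = contradiction pr ¬prime[1]
... | inj₂ p≡q  = p≡q

-- The cases for a prime modulo 3; 3 itself is the only prime with residue 0. Indexing by the number
-- makes a match put it into the required form.
data Residue : ℕ → Set where
  three : Residue 3
  1+3k  : ∀ k → Residue (1 + k * 3)
  2+3k  : ∀ k → Residue (2 + k * 3)

prime⇒residue : ∀ {p} → Prime p → Residue p
prime⇒residue {p} pr with p % 3 | m≡m%n+[m/n]*n p 3 | m%n<n p 3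
... | 0 | p≡ | _ = subst Residue (prime∣prime⇒≡ (from-yes (prime? 3)) pr (divides (p / 3) p≡)) three
... | 1 | p≡ | _ = subst Residue (sym p≡) (1+3k (p / 3))
... | 2 | p≡ | _ = subst Residue (sym p≡) (2+3k (p / 3))
... | suc (suc (suc _)) | _ | s≤s (s≤s (s≤s ()))

-- For odd `k` the number would be even, hence equal to 2, which is not of the form 1 + 3k.
prime[1+3k]⇒6k+1 : ∀ k → Prime (1 + k * 3) → (1 + k * 3) IsOfForm6k+1
prime[1+3k]⇒6k+1 k pr with k % 2 | m≡m%n+[m/n]*n k 2 | m%n<n k 2
... | 0 | k≡ | _ = ℤ.+ (k / 2) , (begin
  ℤ.+ (1 + k * 3)                  ≡⟨ cong (λ z → ℤ.+ (1 + z * 3)) k≡ ⟩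
  ℤ.+ (1 + k / 2 * 2 * 3)          ≡⟨ cong ℤ.+_ (rearrange (k / 2)) ⟩
  ℤ.+ (6 * (k / 2) + 1)            ≡⟨ ℤ.pos-+ (6 * (k / 2)) 1 ⟩
  ℤ.+ (6 * (k / 2)) ℤ.+ ℤ.+ 1      ≡⟨ cong (ℤ._+ ℤ.+ 1) (ℤ.pos-* 6 (k / 2)) ⟩
  ℤ.+ 6 ℤ.* ℤ.+ (k / 2) ℤ.+ ℤ.+ 1  ∎)
  where
  open ≡-Reasoning
  rearrange : ∀ j → 1 + j * 2 * 3 ≡ 6 * j + 1
  rearrange = solve-∀
... | 1 | k≡ | _ = contradiction (prime∣prime⇒≡ prime[2] pr (divides (2 + k / 2 * 3) p≡)) (2≢1+3k k)
  where
  rearrange : ∀ j → 1 + (1 + j * 2) * 3 ≡ (2 + j * 3) * 2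
  rearrange = solve-∀
  p≡ : 1 + k * 3 ≡ (2 + k / 2 * 3) * 2
  p≡ = trans (cong (λ z → 1 + z * 3) k≡) (rearrange (k / 2))
  2≢1+3k : ∀ k → 2 ≢ 1 + k * 3
  2≢1+3k zero    ()
  2≢1+3k (suc k) ()
... | suc (suc _) | _ | s≤s (s≤s ())

-- The integer z may be negative, so 6z = 1 + 3k is passed to absolute values; then 3 would divide 1
-- + 3k and hence 1.
¬6k+1[2+3k] : ∀ k → ¬ (2 + k * 3) IsOfForm6k+1
¬6k+1[2+3k] k (z , eq) = contradiction
  (∣m+n∣m⇒∣n (subst (3 ∣_) (+-comm 1 (k * 3)) 3∣1+3k) (n∣m*n k)) (>⇒∤ {1} {3} (s≤s (s≤s z≤n)))
  where
  6z≡ : ℤ.+ 6 ℤ.* z ≡ ℤ.+ (1 + k * 3)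
  6z≡ = ∙-cancelʳ (ℤ.+ 1) _ _ (trans (sym eq) (cong ℤ.+_ (+-comm 1 (1 + k * 3))))
  3∣1+3k : 3 ∣ 1 + k * 3
  3∣1+3k = subst (3 ∣_) (trans (sym (ℤ.abs-* (ℤ.+ 6) z)) (cong ℤ.∣_∣ 6z≡))
    (∣m⇒∣m*n ℤ.∣ z ∣ (divides 2 refl))

-- Descent on n

m<p*m : ∀ {p} m .{{_ : NonZero m}} → Prime p → m < p * m
m<p*m {p} m pr = subst (m <_) (*-comm m p) (m<m*n m p (nonTrivial⇒n>1 p {{prime⇒nonTrivial pr}}))

norm-homogeneous : ∀ p a b → norm (a * p) (b * p) ≡ p * (p * norm a b)
norm-homogeneous = square
  where
  square : ∀ p a b → a * p * (a * p) + a * p * (b * p) + b * p * (b * p)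
                   ≡ p * (p * (a * a + a * b + b * b))
  square = solve-∀

isNorm-split : ∀ {p n} → Prime p → ¬ IsNorm p → p ∣ n → IsNorm n →
               ∃[ m ] IsNorm m × n ≡ p * (p * m)
isNorm-split {p} pr ¬norm p∣n (a , b , n≡)
  with ∣norm⇒∣ˡ {a = a} {b} pr ¬norm (subst (p ∣_) n≡ p∣n)
     | ∣norm⇒∣ʳ {a = a} {b} pr ¬norm (subst (p ∣_) n≡ p∣n)
... | divides a′ a≡ | divides b′ b≡ = norm a′ b′ , (a′ , b′ , refl)
  , trans n≡ (trans (cong₂ norm a≡ b≡) (norm-homogeneous p a′ b′))

-- Strong induction: if `p` divides `n`, then p² splits off, the cofactor is again a norm, and the
-- exponent falls by 2. Otherwise the exponent is 0.
isNorm⇒2∣exponent : ∀ {p} → Prime p → ¬ IsNorm p →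
                    ∀ n .{{_ : NonZero n}} → IsNorm n → 2 ∣ exponent p n
isNorm⇒2∣exponent {p} pr ¬norm n = <-rec P step n
  where
  P : ℕ → Set
  P n = .{{_ : NonZero n}} → IsNorm n → 2 ∣ exponent p n

  descend : ∀ m → (∀ {k} → k < p * (p * m) → P k) → IsNorm m → P (p * (p * m))
  descend m rec isNorm-m _ = subst (2 ∣_) (sym (exponent-p*p*-≡ m pr))
    (∣m∣n⇒∣m+n ∣-refl (rec (<-trans (m<p*m m pr) (m<p*m (p * m) pr)) isNorm-m))
    where
    instance
      p*m≢0 : NonZero (p * m)
      p*m≢0 = m*n≢0⇒n≢0 p {p * m}
      m≢0 : NonZero m
      m≢0 = m*n≢0⇒n≢0 p {m} {{p*m≢0}}

  step : ∀ n → (∀ {k} → k < n → P k) → P n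
  step n rec isNorm = case p ∣? n of λ where
    (no p∤n)  → subst (2 ∣_) (sym (∤⇒exponent≡0 n p∤n)) (2 ∣0)
    (yes p∣n) → case isNorm-split pr ¬norm p∣n isNorm of λ where
      (m , isNorm-m , refl) → descend m rec isNorm-m isNorm

EvenInertExponents : (n : ℕ) .{{_ : NonZero n}} → Set
EvenInertExponents n = ∀ p → Prime p → p ≢ 3 → ¬ (p IsOfForm6k+1) → 2 ∣ exponent p n

-- Strong induction on `n`, taking off a prime factor `p` that is itself a norm, or else the norm
-- p². The parity condition passes to the cofactor.
evenInertExponents⇒isNorm : ∀ n .{{_ : NonZero n}} → EvenInertExponents n → IsNorm n
evenInertExponents⇒isNorm n = <-rec P step n
  where
  P : ℕ → Set
  P n = .{{_ : NonZero n}} → EvenInertExponents n → IsNorm n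

  step : ∀ n → (∀ {m} → m < n → P m) → P n
  step n rec even with 1⊎prime* n
  ... | inj₁ n≡1 = 1 , 0 , n≡1
  ... | inj₂ (p , m , pr , refl) = cases (prime⇒residue pr)
    where
    instance
      m≢0 : NonZero m
      m≢0 = m*n≢0⇒n≢0 p

    split : p ≡ 3 ⊎ p IsOfForm6k+1 → IsNorm p → IsNorm (p * m)
    split p-split isNorm-p = isNorm-* isNorm-p (rec (m<p*m m pr) λ q qr q≢3 ¬6k+1 →
      -- An inert `q` differs from `p`, so its exponent is the same in `m` as in `p * m`.
      subst (2 ∣_) (exponent-*-≢ m pr λ { refl → [ q≢3 , ¬6k+1 ] p-split }) (even q qr q≢3 ¬6k+1))

    inert : 2 ∣ exponent p (p * m) → IsNorm (p * m)
    inert 2∣e with p ∣? m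
    -- The exponent of `p` in `p * m` would be 1, which is odd.
    ... | no p∤m = contradiction
      (∣1⇒≡1 (subst (2 ∣_) (trans (exponent-*-≡ m pr) (cong suc (∤⇒exponent≡0 m p∤m))) 2∣e)) λ ()
    ... | yes (divides m′ m≡m′*p) with refl ← trans m≡m′*p (*-comm m′ p) =
      subst IsNorm (*-assoc p p m′) (isNorm-* (isNorm-square p) (rec m′<n even′))
      where
      instance
        m′≢0 : NonZero m′
        m′≢0 = m*n≢0⇒n≢0 p
      m′<n : m′ < p * (p * m′)
      m′<n = <-trans (m<p*m m′ pr) (m<p*m (p * m′) pr)
      even′ : EvenInertExponents m′
      even′ q qr q≢3 ¬6k+1 with q ≟ p
      ... | yes refl = ∣m+n∣m⇒∣n (subst (2 ∣_) (exponent-p*p*-≡ m′ pr) 2∣e) ∣-refl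
      ... | no q≢p   = subst (2 ∣_) (exponent-p*p*-≢ m′ pr q≢p) (even q qr q≢3 ¬6k+1)

    cases : Residue p → IsNorm (p * m)
    cases three    = split (inj₁ refl) (1 , 1 , refl)
    cases (1+3k k) with ∃-primitive-cube-root k pr
    ... | B , p∣N = split (inj₂ (prime[1+3k]⇒6k+1 k pr)) (∣B²+B+1⇒isNorm B p∣N)
    cases (2+3k k) = inert (even (2 + k * 3) pr (2+3k≢3 k) (¬6k+1[2+3k] k))
      where
      2+3k≢3 : ∀ k → 2 + k * 3 ≢ 3
      2+3k≢3 zero    ()
      2+3k≢3 (suc k) ()

theorem16 : (n : ℕ) .{{_ : NonZero n}} →
    (∃[ a ] ∃[ b ] n ≡ a ^ 2 + a * b + b ^ 2)
    ⇔ (∀ (p : ℕ) → Prime p → p ≢ 3 → ¬ (p IsOfForm6k+1) → 2 ∣ exponent p n)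
theorem16 n = mk⇔
  (λ (a , b , n≡) p pr p≢3 ¬6k+1 →
    isNorm⇒2∣exponent pr (¬isNorm (prime⇒residue pr) pr p≢3 ¬6k+1) n (a , b , trans n≡ (sym (norm≡ a b))))
  (λ even → let a , b , n≡ = evenInertExponents⇒isNorm n even in a , b , trans n≡ (norm≡ a b))
  where
  square≡ : ∀ a → a * a ≡ a ^ 2
  square≡ a = cong (a *_) (sym (*-identityʳ a))

  norm≡ : ∀ a b → norm a b ≡ a ^ 2 + a * b + b ^ 2
  norm≡ a b = cong₂ (λ x y → x + a * b + y) (square≡ a) (square≡ b)

  ¬isNorm : ∀ {p} → Residue p → Prime p → p ≢ 3 → ¬ (p IsOfForm6k+1) → ¬ IsNorm p
  ¬isNorm three    _  3≢3 _     = contradiction refl 3≢3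
  ¬isNorm (1+3k k) pr _   ¬6k+1 = contradiction (prime[1+3k]⇒6k+1 k pr) ¬6k+1
  ¬isNorm (2+3k k) _  _   _     = ¬isNorm[2+3k] k
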